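{- Let $s\ge 3$ be an integer. There is no $[s^2,s;3]$-bigraph whose order attains the Moore bound $M(s^2,s;3)=(s^2-1)+(s^3-s)$. Instead, the following improved Moore bound holds: every $[s^2,s;3]$-bigraph has at most $$M^*(s^2,s;3)=(s^2-2)(s+1)$$ vertices, this value corresponding to part sizes $N_1=s^2-2$ and $N_2=s^3-2s$.
   Context: Graphs are finite and simple. An $[r,s;d]$-bigraph is a bipartite graph $G=(V,E)$ with stable sets (parts) $V=V_1\cup V_2$, in which every vertex of $V_1$ has degree $r$, every vertex of $V_2$ has degree $s$, and the diameter is $d$. Write $N_i=|V_i|$ for $i=1,2$; the order of $G$ is $N_1+N_2$. For $r\ge s$, the Moore bound for diameter $3$ is $$M(r,s;3)=\left\lfloor \frac{1+s(r-1)}{\rho}\right\rfloor(\rho+\sigma),\qquad \rho=\frac{r}{\gcd(r,s)},\quad \sigma=\frac{s}{\gcd(r,s)},$$ which is an upper bound on the order of any $[r,s;3]$-bigraph. For $r=s^2$ it equals $(s^2-1)+(s^3-s)$, corresponding to $N_1=s^2-1$, $N_2=s^3-s$. The improved bound is an upper bound; no claim is made that it is attained. -}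

module Defs where

open import Data.Fin using (Fin)
open import Data.Fin.Subset using (Subset; _∈_; ∁; ∣_∣)
open import Data.Nat
open import Data.Nat.DivMod using (_/_)
open import Data.Nat.GCD using (gcd; gcd[m,n]≢0; m/gcd[m,n]≢0)
open import Data.Nat.Properties using (m^n≢0; ≤-trans)
open import Data.Product using (_×_; ∃; ∃₂)
open import Data.Sum using (inj₁)
open import Data.Vec using (tabulate)
open import Level using (0ℓ)
open import Relation.Binary using (Rel; Decidable; Symmetric; Irreflexive)
open import Relation.Binary.PropositionalEquality using (_≡_)
open import Relation.Nullary using (¬_; does)

-- Decidability of adjacency is what makes degrees computable.
record Graph (n : ℕ) : Set₁ where
  infix 4 _~_ _~?_
  field
    _~_      : Rel (Fin n) 0ℓ
    _~?_     : Decidable _~_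
    ~-sym    : Symmetric _~_
    ~-irrefl : Irreflexive _≡_ _~_

  neighbours : Fin n → Subset n
  neighbours u = tabulate λ v → does (u ~? v)

  degree : Fin n → ℕ
  degree u = ∣ neighbours u ∣

  data Walk : ℕ → Fin n → Fin n → Set where
    []  : ∀ {u} → Walk 0 u u
    _∷_ : ∀ {k u v w} → u ~ v → Walk k v w → Walk (suc k) u w

  IsDistance : Fin n → Fin n → ℕ → Set
  IsDistance u v k = Walk k u v × (∀ j → Walk j u v → k ≤ j)

  -- In particular the graph is connected and nonempty.
  HasDiameter : ℕ → Set
  HasDiameter d = (∀ u v → ∃ λ k → IsDistance u v k × k ≤ d)
                × ∃₂ λ u v → IsDistance u v d

  Stable : Subset n → Set
  Stable p = ∀ {u v} → u ∈ p → v ∈ p → ¬ (u ~ v)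

record Bigraph (r s d : ℕ) : Set₁ where
  field
    order : ℕ
    graph : Graph order

  open Graph graph public

  field
    V₁ : Subset order

  V₂ : Subset order
  V₂ = ∁ V₁

  field
    V₁-stable : Stable V₁
    V₂-stable : Stable V₂
    V₁-degree : ∀ {v} → v ∈ V₁ → degree v ≡ r
    V₂-degree : ∀ {v} → v ∈ V₂ → degree v ≡ s
    diameter  : HasDiameter d

  N₁ N₂ : ℕ
  N₁ = ∣ V₁ ∣
  N₂ = ∣ V₂ ∣

-- ⌊(1 + s(r - 1)) / ρ⌋ (ρ + σ), a bound on the order of [r,s;3]-bigraphs
-- when r ≥ s.
mooreBound₃ : (r s : ℕ) .{{_ : NonZero r}} → ℕ
mooreBound₃ r s = ((1 + s * (r ∸ 1)) / ρ) * (ρ + σ)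
  where
  instance
    gcd-nonZero : NonZero (gcd r s)
    gcd-nonZero = ≢-nonZero (gcd[m,n]≢0 r s (inj₁ (≢-nonZero⁻¹ r)))

  ρ σ : ℕ
  ρ = r / gcd r s
  σ = s / gcd r s

  instance
    ρ-nonZero : NonZero ρ
    ρ-nonZero = ≢-nonZero (m/gcd[m,n]≢0 r s)

square-nonZero : ∀ {s} → 3 ≤ s → NonZero (s ^ 2)
square-nonZero {s} 3≤s =
  m^n≢0 s 2 {{>-nonZero (≤-trans (s≤s z≤n) 3≤s)}}

{-# OPTIONS --safe #-}

-- Read V₂ as blocks on the points V₁.  Diameter 3 makes any two blocks meet,
-- so counting the pairs (point of B, block through it) around a block B gives
-- N₂ + (s − 1) ≤ s³, that is N₁ < s².  If N₁ = s² − 1, the count leaves an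
-- excess of one, so no block B through x and y lets more than two blocks pass
-- through both; hence two points lie in at most two common blocks.  Counting
-- around a point then gives s³ ≤ s² + 2 (N₁ − 1) = 3s² − 4, contradicting s ≥ 3.
module Submission where

open import Defs
open import Data.Bool using (if_then_else_; true; false)
open import Data.Fin using (Fin; zero; suc; _≟_)
open import Data.Fin.Properties using (any?)
open import Data.Fin.Subset using (Subset; _∈_; ∣_∣; inside; outside)
open import Data.Fin.Subset.Properties
  using (_∈?_; ∣∁p∣≡n∸∣p∣; ∣p∣≤n; x∉p⇒x∈∁p; x∈∁p⇒x∉p; x∉∁p⇒x∈p)
open import Data.Nat hiding (_≟_)
open import Data.Nat.Divisibility using (n∣m*n)
open import Data.Nat.DivMod using (_/_; /-congˡ; m*n/n≡m; n/n≡1; +-distrib-/-∣ʳ; m<n⇒m/n≡0)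
open import Data.Nat.GCD using (gcd; c*gcd[m,n]≡gcd[cm,cn]; gcd-zeroʳ)
open import Data.Nat.Properties hiding (_≟_)
open import Data.Product using (_×_; ∃; _,_; proj₁; proj₂)
open import Data.Vec using ([]; _∷_; tabulate)
open import Function using (_∘_)
open import Relation.Binary.PropositionalEquality
  using (_≡_; _≢_; refl; sym; trans; cong; cong₂; subst; module ≡-Reasoning)
open import Relation.Nullary using (Dec; yes; no; does; ¬_; contradiction)
open import Relation.Nullary.Decidable using (_×-dec_)
open import Relation.Unary using (Decidable)

open import Algebra.Properties.Semiring.Sum +-*-semiring
  using (sum; sum-syntax; sum-cong-≗; ∑-distrib-+; ∑-comm;
         *-distribˡ-sum; *-distribʳ-sum; sum-replicate-zero)

-- Indicators and finite sums.

private
  variable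
    n : ℕ
    A : Set

-- Branching on `does` rather than on the proof lets `𝟙 (suc i ≟ suc j)` reduce to `𝟙 (i ≟ j)`, on
-- which the inductions below rely.
𝟙 : Dec A → ℕ
𝟙 A? = if does A? then 1 else 0

𝟙-yes : (A? : Dec A) → A → 𝟙 A? ≡ 1
𝟙-yes (yes _) _ = refl
𝟙-yes (no ¬a) a = contradiction a ¬a

𝟙-no : (A? : Dec A) → ¬ A → 𝟙 A? ≡ 0
𝟙-no (yes a) ¬a = contradiction a ¬a
𝟙-no (no _)  _  = refl

∑-mono : {f g : Fin n → ℕ} → (∀ i → f i ≤ g i) → sum f ≤ sum g
∑-mono {zero}  f≤g = z≤n
∑-mono {suc n} f≤g = +-mono-≤ (f≤g zero) (∑-mono (f≤g ∘ suc))

term≤∑ : (f : Fin n → ℕ) (i : Fin n) → f i ≤ sum f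
term≤∑ f zero    = m≤m+n (f zero) _
term≤∑ f (suc i) = ≤-trans (term≤∑ (f ∘ suc) i) (m≤n+m _ (f zero))

terms≤∑ : (i : Fin n) (f : Fin n → ℕ) {j : Fin n} → i ≢ j → f i + f j ≤ sum f
terms≤∑ zero    f {zero}  i≢j = contradiction refl i≢j
terms≤∑ zero    f {suc j} i≢j = +-monoʳ-≤ (f zero) (term≤∑ (f ∘ suc) j)
terms≤∑ (suc i) f {zero}  i≢j rewrite +-comm (f (suc i)) (f zero) =
  +-monoʳ-≤ (f zero) (term≤∑ (f ∘ suc) i)
terms≤∑ (suc i) f {suc j} i≢j =
  ≤-trans (terms≤∑ i (f ∘ suc) (i≢j ∘ cong suc)) (m≤n+m _ (f zero))

∑-≟ : (i : Fin n) → ∑[ j < n ] 𝟙 (i ≟ j) ≡ 1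
∑-≟ {suc n} zero    = cong suc (sum-replicate-zero n)
∑-≟ {suc n} (suc i) = ∑-≟ i

-- Puts a correction at a single vertex under the summation sign, so that sums can be compared
-- termwise.
∑-≟-* : (i : Fin n) (k : ℕ) → ∑[ j < n ] (𝟙 (i ≟ j) * k) ≡ k
∑-≟-* {n} i k = begin
  ∑[ j < n ] (𝟙 (i ≟ j) * k)  ≡⟨ *-distribʳ-sum k (λ j → 𝟙 (i ≟ j)) ⟨
  ∑[ j < n ] 𝟙 (i ≟ j) * k    ≡⟨ cong (_* k) (∑-≟ i) ⟩
  1 * k                       ≡⟨ *-identityˡ k ⟩
  k                           ∎
  where open ≡-Reasoning

∣p∣≡∑ : (p : Subset n) → ∣ p ∣ ≡ ∑[ i < n ] 𝟙 (i ∈? p)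
∣p∣≡∑ []            = refl
∣p∣≡∑ (inside  ∷ p) = cong suc (∣p∣≡∑ p)
∣p∣≡∑ (outside ∷ p) = ∣p∣≡∑ p

∣tabulate∣≡∑ : {P : Fin n → Set} (P? : Decidable P) →
               ∣ tabulate (does ∘ P?) ∣ ≡ ∑[ i < n ] 𝟙 (P? i)
∣tabulate∣≡∑ {zero}  P? = refl
∣tabulate∣≡∑ {suc n} P? with does (P? zero)
... | true  = cong suc (∣tabulate∣≡∑ (P? ∘ suc))
... | false = ∣tabulate∣≡∑ (P? ∘ suc)

-- Common neighbours in a graph.

module CommonNeighbours (Γ : Graph n) where
  open Graph Γ

  adj : Fin n → Fin n → ℕ
  adj u v = 𝟙 (u ~? v)

  adj-comm : ∀ u v → adj u v ≡ adj v u
  adj-comm u v with u ~? v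
  ... | yes u~v = sym (𝟙-yes (v ~? u) (~-sym u~v))
  ... | no  u≁v = sym (𝟙-no (v ~? u) (u≁v ∘ ~-sym))

  degree≡∑ : ∀ u → degree u ≡ ∑[ v < n ] adj u v
  degree≡∑ u = ∣tabulate∣≡∑ (u ~?_)

  -- An entry of the squared adjacency matrix: for two blocks the size of their intersection, for
  -- two points the number of blocks through both.
  codegree : Fin n → Fin n → ℕ
  codegree u v = ∑[ w < n ] (adj u w * adj v w)

  codegree-self : ∀ u → codegree u u ≡ degree u
  codegree-self u = trans (sum-cong-≗ idem) (sym (degree≡∑ u))
    where
    idem : ∀ w → adj u w * adj u w ≡ adj u w
    idem w with does (u ~? w)
    ... | true  = refl
    ... | false = refl

  adj²≡1 : ∀ {u v w} → u ~ w → v ~ w → adj u w * adj v w ≡ 1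
  adj²≡1 {u} {v} {w} u~w v~w = cong₂ _*_ (𝟙-yes (u ~? w) u~w) (𝟙-yes (v ~? w) v~w)

  codegree≡0 : ∀ {u v} → (∀ w → u ~ w → ¬ v ~ w) → codegree u v ≡ 0
  codegree≡0 {u} {v} disjoint = trans (sum-cong-≗ vanish) (sum-replicate-zero n)
    where
    vanish : ∀ w → adj u w * adj v w ≡ 0
    vanish w with u ~? w
    ... | yes u~w = trans (*-identityˡ _) (𝟙-no (v ~? w) (disjoint w u~w))
    ... | no  _   = refl

  1≤codegree : ∀ {u v w} → u ~ w → v ~ w → 1 ≤ codegree u v
  1≤codegree {u} {v} {w} u~w v~w =
    subst (_≤ codegree u v) (adj²≡1 u~w v~w) (term≤∑ _ w)

  2≤codegree : ∀ {u v w x} → w ≢ x → u ~ w → v ~ w → u ~ x → v ~ x → 2 ≤ codegree u v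
  2≤codegree {u} {v} {w} w≢x u~w v~w u~x v~x =
    subst (_≤ codegree u v) (cong₂ _+_ (adj²≡1 u~w v~w) (adj²≡1 u~x v~x))
      (terms≤∑ w (λ z → adj u z * adj v z) w≢x)

  -- Both sides count the walks of length two from `u`; grouped by middle vertex `w`, each neighbour
  -- of `u` contributes `degree w`.
  ∑-codegree : ∀ u {d} → (∀ {w} → u ~ w → degree w ≡ d) →
               ∑[ v < n ] codegree u v ≡ degree u * d
  ∑-codegree u {d} deg = begin
    ∑[ v < n ] ∑[ w < n ] (adj u w * adj v w)  ≡⟨ ∑-comm (λ v w → adj u w * adj v w) ⟩
    ∑[ w < n ] ∑[ v < n ] (adj u w * adj v w)  ≡⟨ sum-cong-≗ step ⟩
    ∑[ w < n ] (adj u w * d)                   ≡⟨ *-distribʳ-sum d (adj u) ⟨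
    ∑[ w < n ] adj u w * d                     ≡⟨ cong (_* d) (degree≡∑ u) ⟨
    degree u * d                               ∎
    where
    open ≡-Reasoning
    weigh : ∀ w → adj u w * degree w ≡ adj u w * d
    weigh w with u ~? w
    ... | yes u~w = cong (1 *_) (deg u~w)
    ... | no  _   = refl
    step : ∀ w → ∑[ v < n ] (adj u w * adj v w) ≡ adj u w * d
    step w = begin
      ∑[ v < n ] (adj u w * adj v w)  ≡⟨ *-distribˡ-sum (adj u w) (λ v → adj v w) ⟨
      adj u w * ∑[ v < n ] adj v w    ≡⟨ cong (adj u w *_) (sum-cong-≗ (λ v → adj-comm v w)) ⟩
      adj u w * ∑[ v < n ] adj w v    ≡⟨ cong (adj u w *_) (degree≡∑ w) ⟨
      adj u w * degree w              ≡⟨ weigh w ⟩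
      adj u w * d                     ∎

-- Bigraphs of diameter 3: edge count and meeting blocks.

module Diameter₃ {r s} (G : Bigraph r s 3) where
  open Bigraph G
  open CommonNeighbours graph public

  ~⇒∈V₂ : ∀ {u v} → u ∈ V₁ → u ~ v → v ∈ V₂
  ~⇒∈V₂ u∈V₁ u~v = x∉p⇒x∈∁p λ v∈V₁ → V₁-stable u∈V₁ v∈V₁ u~v

  ~⇒∈V₁ : ∀ {u v} → u ∈ V₂ → u ~ v → v ∈ V₁
  ~⇒∈V₁ u∈V₂ u~v = x∉∁p⇒x∈p λ v∈V₂ → V₂-stable u∈V₂ v∈V₂ u~v

  V₁∩V₂ : ∀ {u} → u ∈ V₁ → ¬ u ∈ V₂
  V₁∩V₂ u∈V₁ u∈V₂ = x∈∁p⇒x∉p u∈V₂ u∈V₁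

  order≡N₁+N₂ : order ≡ N₁ + N₂
  order≡N₁+N₂ = sym (trans (cong (N₁ +_) (∣∁p∣≡n∸∣p∣ V₁)) (m+[n∸m]≡n (∣p∣≤n V₁)))

  -- Counts the edges once from their ends in `V₁` and once from their ends in `V₂`.
  N₁*r≡N₂*s : N₁ * r ≡ N₂ * s
  N₁*r≡N₂*s = begin
    N₁ * r                                                 ≡⟨ weighted V₁ V₁-degree ⟩
    ∑[ u < order ] ∑[ v < order ] (𝟙 (u ∈? V₁) * adj u v)  ≡⟨ ∑-comm (λ u v → 𝟙 (u ∈? V₁) * adj u v) ⟩
    ∑[ v < order ] ∑[ u < order ] (𝟙 (u ∈? V₁) * adj u v)  ≡⟨ sum-cong-≗ (λ v → sum-cong-≗ (λ u → swap u v)) ⟩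
    ∑[ v < order ] ∑[ u < order ] (𝟙 (v ∈? V₂) * adj v u)  ≡⟨ weighted V₂ V₂-degree ⟨
    N₂ * s                                                 ∎
    where
    open ≡-Reasoning
    swap : ∀ u v → 𝟙 (u ∈? V₁) * adj u v ≡ 𝟙 (v ∈? V₂) * adj v u
    swap u v rewrite adj-comm v u with u ~? v
    ... | no  _   = trans (*-zeroʳ (𝟙 (u ∈? V₁))) (sym (*-zeroʳ (𝟙 (v ∈? V₂))))
    ... | yes u~v with u ∈? V₁
    ...   | yes u∈V₁ = cong (_* 1) (sym (𝟙-yes (v ∈? V₂) (~⇒∈V₂ u∈V₁ u~v)))
    ...   | no  u∉V₁ = cong (_* 1) (sym (𝟙-no (v ∈? V₂)
                         (V₁∩V₂ (~⇒∈V₁ (x∉p⇒x∈∁p u∉V₁) u~v))))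
    weighted : ∀ p {d} → (∀ {v} → v ∈ p → degree v ≡ d) →
               ∣ p ∣ * d ≡ ∑[ u < order ] ∑[ v < order ] (𝟙 (u ∈? p) * adj u v)
    weighted p {d} deg = begin
      ∣ p ∣ * d                                             ≡⟨ cong (_* d) (∣p∣≡∑ p) ⟩
      ∑[ u < order ] 𝟙 (u ∈? p) * d                         ≡⟨ *-distribʳ-sum d (λ u → 𝟙 (u ∈? p)) ⟩
      ∑[ u < order ] (𝟙 (u ∈? p) * d)                       ≡⟨ sum-cong-≗ term ⟩
      ∑[ u < order ] ∑[ v < order ] (𝟙 (u ∈? p) * adj u v)  ∎
      where
      term : ∀ u → 𝟙 (u ∈? p) * d ≡ ∑[ v < order ] (𝟙 (u ∈? p) * adj u v)
      term u with u ∈? p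
      ... | no  _   = sym (sum-replicate-zero order)
      ... | yes u∈p = begin
        1 * d                         ≡⟨ cong (1 *_) (trans (sym (deg u∈p)) (degree≡∑ u)) ⟩
        1 * ∑[ v < order ] adj u v    ≡⟨ *-distribˡ-sum 1 (adj u) ⟩
        ∑[ v < order ] (1 * adj u v)  ∎

  -- Some pair is at distance 3, and the first step of its walk is an edge. It provides the point
  -- and the block around which to count.
  edge : ∃ λ u → ∃ λ v → u ∈ V₁ × v ∈ V₂
  edge with proj₂ diameter
  ... | u , _ , (_∷_ {v = v} u~v _) , _ with u ∈? V₁
  ...   | yes u∈V₁ = u , v , u∈V₁ , ~⇒∈V₂ u∈V₁ u~v
  ...   | no  u∉V₁ = v , u , ~⇒∈V₁ (x∉p⇒x∈∁p u∉V₁) u~v , x∉p⇒x∈∁p u∉V₁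

  -- A walk within one part has even length, so two distinct blocks are at distance exactly 2, and
  -- the middle vertex is a common point.
  V₂-meet : ∀ {u v} → u ∈ V₂ → v ∈ V₂ → u ≢ v → 1 ≤ codegree u v
  V₂-meet {u} {v} u∈V₂ v∈V₂ u≢v with proj₁ diameter u v
  ... | 0 , ([] , _) , _ = contradiction refl u≢v
  ... | 1 , ((u~v ∷ []) , _) , _ = contradiction u~v (V₂-stable u∈V₂ v∈V₂)
  ... | 2 , ((u~w ∷ (w~v ∷ [])) , _) , _ = 1≤codegree u~w (~-sym w~v)
  ... | 3 , ((u~w ∷ (w~x ∷ (x~v ∷ []))) , _) , _ =
    contradiction x~v (V₂-stable (~⇒∈V₂ (~⇒∈V₁ u∈V₂ u~w) w~x) v∈V₂)
  ... | suc (suc (suc (suc _))) , _ , s≤s (s≤s (s≤s ()))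

  -- Double counting around a block and around a point.

  V₁-∑-codegree : ∀ {x} → x ∈ V₁ → ∑[ y < order ] codegree x y ≡ r * s
  V₁-∑-codegree {x} x∈V₁ =
    trans (∑-codegree x (V₂-degree ∘ ~⇒∈V₂ x∈V₁)) (cong (_* s) (V₁-degree x∈V₁))

  V₂-∑-codegree : ∀ {B} → B ∈ V₂ → ∑[ C < order ] codegree B C ≡ s * r
  V₂-∑-codegree {B} B∈V₂ =
    trans (∑-codegree B (V₁-degree ∘ ~⇒∈V₁ B∈V₂)) (cong (_* r) (V₂-degree B∈V₂))

  -- The excess t counts intersections beyond the one forced by the diameter,
  -- and k is what the block B itself still leaves over.
  block-count : ∀ {B} → B ∈ V₂ → (t : Fin order → ℕ) (k : ℕ) →
                (∀ {C} → C ∈ V₁ → t C ≡ 0) →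
                (∀ {C} → C ∈ V₂ → B ≢ C → 1 + t C ≤ codegree B C) →
                1 + t B + k ≤ s →
                N₂ + sum t + k ≤ s * r
  block-count {B} B∈V₂ t k t-V₁ t-V₂ t-B = begin
    N₂ + sum t + k
      ≡⟨ cong₂ _+_ (cong (_+ sum t) (∣p∣≡∑ V₂)) (sym (∑-≟-* B k)) ⟩
    ∑[ C < order ] 𝟙 (C ∈? V₂) + sum t + ∑[ C < order ] (𝟙 (B ≟ C) * k)
      ≡⟨ cong (_+ ∑[ C < order ] (𝟙 (B ≟ C) * k)) (∑-distrib-+ (λ C → 𝟙 (C ∈? V₂)) t) ⟨
    ∑[ C < order ] (𝟙 (C ∈? V₂) + t C) + ∑[ C < order ] (𝟙 (B ≟ C) * k)
      ≡⟨ ∑-distrib-+ (λ C → 𝟙 (C ∈? V₂) + t C) (λ C → 𝟙 (B ≟ C) * k) ⟨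
    ∑[ C < order ] (𝟙 (C ∈? V₂) + t C + 𝟙 (B ≟ C) * k)
      ≤⟨ ∑-mono bound ⟩
    ∑[ C < order ] codegree B C
      ≡⟨ V₂-∑-codegree B∈V₂ ⟩
    s * r ∎
    where
    open ≤-Reasoning
    bound : ∀ C → 𝟙 (C ∈? V₂) + t C + 𝟙 (B ≟ C) * k ≤ codegree B C
    bound C with B ≟ C
    ... | yes refl rewrite 𝟙-yes (B ∈? V₂) B∈V₂ | codegree-self B | V₂-degree B∈V₂
                         | *-identityˡ k = t-B
    ... | no B≢C with C ∈? V₂
    ...   | yes C∈V₂ rewrite +-identityʳ (t C) = t-V₂ C∈V₂ B≢C
    ...   | no  C∉V₂ rewrite t-V₁ (x∉∁p⇒x∈p C∉V₂) = z≤n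

  -- The block count with zero excess: `B` meets itself in `s` points, one of which is already
  -- counted in `N₂`.
  N₂-bound : 1 ≤ s → N₂ + (s ∸ 1) ≤ s * r
  N₂-bound 1≤s with edge
  ... | _ , B , _ , B∈V₂ = subst (λ z → z + (s ∸ 1) ≤ s * r)
    (trans (cong (N₂ +_) (sum-replicate-zero order)) (+-identityʳ N₂))
    (block-count B∈V₂ (λ _ → 0) (s ∸ 1) (λ _ → refl) (V₂-meet B∈V₂)
      (≤-reflexive (m+[n∸m]≡n 1≤s)))

  -- The excess is 1 on the blocks through both `x` and `y`, since each of them other than `B` meets
  -- `B` at least twice; it sums to `codegree x y`. At `B` the forced intersection and the excess
  -- use up 2 of the `s` points.
  N₂+codegree-bound : ∀ {x y B} → 2 ≤ s → x ≢ y → B ∈ V₂ → B ~ x → B ~ y →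
                      N₂ + codegree x y + (s ∸ 2) ≤ s * r
  N₂+codegree-bound {x} {y} {B} 2≤s x≢y B∈V₂ B~x B~y =
    block-count B∈V₂ (λ C → adj x C * adj y C) (s ∸ 2) off-V₂ on-V₂ at-B
    where
    off-V₂ : ∀ {C} → C ∈ V₁ → adj x C * adj y C ≡ 0
    off-V₂ {C} C∈V₁ =
      cong (_* adj y C) (𝟙-no (x ~? C) (V₁-stable (~⇒∈V₁ B∈V₂ B~x) C∈V₁))
    on-V₂ : ∀ {C} → C ∈ V₂ → B ≢ C → 1 + adj x C * adj y C ≤ codegree B C
    on-V₂ {C} C∈V₂ B≢C with x ~? C | y ~? C
    ... | yes x~C | yes y~C = 2≤codegree x≢y B~x (~-sym x~C) B~y (~-sym y~C)
    ... | yes _   | no _    = V₂-meet B∈V₂ C∈V₂ B≢C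
    ... | no  _   | yes _   = V₂-meet B∈V₂ C∈V₂ B≢C
    ... | no  _   | no _    = V₂-meet B∈V₂ C∈V₂ B≢C
    at-B : 1 + adj x B * adj y B + (s ∸ 2) ≤ s
    at-B rewrite adj²≡1 (~-sym B~x) (~-sym B~y) = ≤-reflexive (m+[n∸m]≡n 2≤s)

  -- Here `m` is the slack in the block count. If some block passes through both points, counting
  -- around it leaves room for only `2 + m` such blocks; otherwise the codegree is 0.
  V₁-codegree≤ : ∀ {x y} m → 2 ≤ s → s * r ≤ N₂ + s + m → x ∈ V₁ → x ≢ y →
                 codegree x y ≤ 2 + m
  V₁-codegree≤ {x} {y} m 2≤s s*r≤ x∈V₁ x≢y
    with any? (λ B → (x ~? B) ×-dec (y ~? B))
  ... | no disjoint rewrite codegree≡0 (λ w p q → disjoint (w , p , q)) = z≤n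
  ... | yes (B , x~B , y~B) = +-cancelʳ-≤ (s ∸ 2) _ _ (+-cancelˡ-≤ N₂ _ _ (begin
    N₂ + (codegree x y + (s ∸ 2))  ≡⟨ +-assoc N₂ _ _ ⟨
    N₂ + codegree x y + (s ∸ 2)
      ≤⟨ N₂+codegree-bound 2≤s x≢y (~⇒∈V₂ x∈V₁ x~B) (~-sym x~B) (~-sym y~B) ⟩
    s * r                   ≤⟨ s*r≤ ⟩
    N₂ + s + m              ≡⟨ +-assoc N₂ s m ⟩
    N₂ + (s + m)            ≡⟨ cong (λ z → N₂ + (z + m)) (m+[n∸m]≡n 2≤s) ⟨
    N₂ + (2 + (s ∸ 2) + m)  ≡⟨ cong (λ z → N₂ + (2 + z)) (+-comm (s ∸ 2) m) ⟩
    N₂ + (2 + m + (s ∸ 2))  ∎))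
    where open ≤-Reasoning

  -- Every point is charged `k`. The point `x` has codegree `r` with itself, hence the extra
  -- `r ∸ k`; blocks share no neighbour with `x`.
  point-count : ∀ {x k} → x ∈ V₁ → k ≤ r → (∀ {y} → x ≢ y → codegree x y ≤ k) →
                r * s ≤ N₁ * k + (r ∸ k)
  point-count {x} {k} x∈V₁ k≤r cod≤k = begin
    r * s                        ≡⟨ V₁-∑-codegree x∈V₁ ⟨
    ∑[ y < order ] codegree x y  ≤⟨ ∑-mono bound ⟩
    ∑[ y < order ] (𝟙 (y ∈? V₁) * k + 𝟙 (x ≟ y) * (r ∸ k))
      ≡⟨ ∑-distrib-+ (λ y → 𝟙 (y ∈? V₁) * k) (λ y → 𝟙 (x ≟ y) * (r ∸ k)) ⟩
    ∑[ y < order ] (𝟙 (y ∈? V₁) * k) + ∑[ y < order ] (𝟙 (x ≟ y) * (r ∸ k))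
      ≡⟨ cong₂ _+_ (sym (*-distribʳ-sum k (λ y → 𝟙 (y ∈? V₁)))) (∑-≟-* x (r ∸ k)) ⟩
    ∑[ y < order ] 𝟙 (y ∈? V₁) * k + (r ∸ k)
      ≡⟨ cong (λ z → z * k + (r ∸ k)) (∣p∣≡∑ V₁) ⟨
    N₁ * k + (r ∸ k) ∎
    where
    open ≤-Reasoning
    bound : ∀ y → codegree x y ≤ 𝟙 (y ∈? V₁) * k + 𝟙 (x ≟ y) * (r ∸ k)
    bound y with x ≟ y
    ... | yes refl rewrite 𝟙-yes (x ∈? V₁) x∈V₁ | codegree-self x | V₁-degree x∈V₁
                         | *-identityˡ k | *-identityˡ (r ∸ k) =
      ≤-reflexive (sym (m+[n∸m]≡n k≤r))
    ... | no x≢y with y ∈? V₁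
    ...   | yes _ rewrite *-identityˡ k | +-identityʳ k = cod≤k x≢y
    ...   | no y∉V₁ = ≤-reflexive (codegree≡0 λ w x~w y~w →
            V₂-stable (x∉p⇒x∈∁p y∉V₁) (~⇒∈V₂ x∈V₁ x~w) y~w)

-- The case `r = s ^ 2`: bounding `N₁`.

module _ {s} (3≤s : 3 ≤ s) where
  private
    instance
      s≢0 : NonZero s
      s≢0 = >-nonZero (≤-trans (s≤s z≤n) 3≤s)

    1<s : 1 < s
    1<s = ≤-trans (s≤s (s≤s z≤n)) 3≤s

    2≤s² : 2 ≤ s ^ 2
    2≤s² = ≤-trans 1<s (m≤m*n s (s ^ 1) {{m^n≢0 s 1}})

  module _ (G : Bigraph (s ^ 2) s 3) where
    open Bigraph G using (order; N₁; N₂)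
    open Diameter₃ G

    N₂≡s*N₁ : N₂ ≡ s * N₁
    N₂≡s*N₁ = *-cancelʳ-≡ N₂ (s * N₁) s (begin
      N₂ * s        ≡⟨ N₁*r≡N₂*s ⟨
      N₁ * s ^ 2    ≡⟨ cong (λ z → N₁ * (s * z)) (*-identityʳ s) ⟩
      N₁ * (s * s)  ≡⟨ *-assoc N₁ s s ⟨
      N₁ * s * s    ≡⟨ cong (_* s) (*-comm N₁ s) ⟩
      s * N₁ * s    ∎)
      where open ≡-Reasoning

    order≡N₁*[s+1] : order ≡ N₁ * (s + 1)
    order≡N₁*[s+1] = begin
      order         ≡⟨ order≡N₁+N₂ ⟩
      N₁ + N₂       ≡⟨ cong (N₁ +_) N₂≡s*N₁ ⟩
      N₁ + s * N₁   ≡⟨ *-comm (1 + s) N₁ ⟩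
      N₁ * (1 + s)  ≡⟨ cong (N₁ *_) (+-comm 1 s) ⟩
      N₁ * (s + 1)  ∎
      where open ≡-Reasoning

    N₁<s² : N₁ < s ^ 2
    N₁<s² = *-cancelˡ-< s N₁ (s ^ 2) (begin-strict
      s * N₁            <⟨ m<m+n (s * N₁) (m<n⇒0<n∸m 1<s) ⟩
      s * N₁ + (s ∸ 1)  ≡⟨ cong (_+ (s ∸ 1)) N₂≡s*N₁ ⟨
      N₂ + (s ∸ 1)      ≤⟨ N₂-bound (<⇒≤ 1<s) ⟩
      s * s ^ 2         ∎)
      where open ≤-Reasoning

    -- Equality would leave no slack in the block count, so two points would share at most two
    -- blocks, too few for the count around a point.
    1+N₁≢s² : suc N₁ ≢ s ^ 2
    1+N₁≢s² 1+N₁≡s² with edge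
    ... | x , _ , x∈V₁ , _ = <-irrefl refl (begin-strict
      s ^ 2 * s             ≤⟨ point-count x∈V₁ 2≤s² (V₁-codegree≤ 0 1<s s³≤ x∈V₁) ⟩
      -- The coarse bound `3 * s ^ 2` already suffices, because `3 ≤ s`.
      N₁ * 2 + (s ^ 2 ∸ 2)  <⟨ +-mono-<-≤ (*-monoˡ-< 2 N₁<s²) (m∸n≤m (s ^ 2) 2) ⟩
      s ^ 2 * 2 + s ^ 2     ≡⟨ +-comm (s ^ 2 * 2) (s ^ 2) ⟩
      s ^ 2 + s ^ 2 * 2     ≡⟨ *-suc (s ^ 2) 2 ⟨
      s ^ 2 * 3             ≤⟨ *-monoʳ-≤ (s ^ 2) 3≤s ⟩
      s ^ 2 * s             ∎)
      where
      open ≤-Reasoning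
      s³≤ : s * s ^ 2 ≤ N₂ + s + 0
      s³≤ = ≤-reflexive (begin-equality
        s * s ^ 2   ≡⟨ cong (s *_) 1+N₁≡s² ⟨
        s * suc N₁  ≡⟨ *-suc s N₁ ⟩
        s + s * N₁  ≡⟨ +-comm s (s * N₁) ⟩
        s * N₁ + s  ≡⟨ cong (_+ s) N₂≡s*N₁ ⟨
        N₂ + s      ≡⟨ +-identityʳ (N₂ + s) ⟨
        N₂ + s + 0  ∎)

    N₁≤s²∸2 : N₁ ≤ s ^ 2 ∸ 2
    N₁≤s²∸2 = m+n≤o⇒m≤o∸n N₁
      (subst (_≤ s ^ 2) (+-comm 2 N₁) (≤∧≢⇒< N₁<s² 1+N₁≢s²))

  -- Evaluation of the Moore bound and of its improvement.

  [s²∸k][s+1] : ∀ k → (s ^ 2 ∸ k) * (s + 1) ≡ (s ^ 2 ∸ k) + (s ^ 3 ∸ k * s)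
  [s²∸k][s+1] k = begin
    (s ^ 2 ∸ k) * (s + 1)              ≡⟨ cong ((s ^ 2 ∸ k) *_) (+-comm s 1) ⟩
    (s ^ 2 ∸ k) * (1 + s)              ≡⟨ *-suc (s ^ 2 ∸ k) s ⟩
    (s ^ 2 ∸ k) + (s ^ 2 ∸ k) * s      ≡⟨ cong ((s ^ 2 ∸ k) +_) (*-distribʳ-∸ s (s ^ 2) k) ⟩
    (s ^ 2 ∸ k) + (s ^ 2 * s ∸ k * s)  ≡⟨ cong (λ z → (s ^ 2 ∸ k) + (z ∸ k * s)) (*-comm (s ^ 2) s) ⟩
    (s ^ 2 ∸ k) + (s ^ 3 ∸ k * s)      ∎
    where open ≡-Reasoning

  gcd[s²,s]≡s : gcd (s ^ 2) s ≡ s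
  gcd[s²,s]≡s = begin
    gcd (s ^ 2) s            ≡⟨ cong (gcd (s ^ 2)) (*-identityʳ s) ⟨
    gcd (s * s ^ 1) (s * 1)  ≡⟨ c*gcd[m,n]≡gcd[cm,cn] s (s ^ 1) 1 ⟨
    s * gcd (s ^ 1) 1        ≡⟨ cong (s *_) (gcd-zeroʳ (s ^ 1)) ⟩
    s * 1                    ≡⟨ *-identityʳ s ⟩
    s                        ∎
    where open ≡-Reasoning

  -- The divisors g and ρ are kept abstract because mooreBound₃ carries its own
  -- proofs that they are nonzero.
  mooreBound₃-eval : ∀ g ρ .{{_ : NonZero g}} .{{_ : NonZero ρ}} → g ≡ s → ρ ≡ s ^ 2 / g →
                     ((1 + s * (s ^ 2 ∸ 1)) / ρ) * (ρ + s / g) ≡ (s ^ 2 ∸ 1) * (s + 1)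
  mooreBound₃-eval .s ρ refl ρ≡ = begin
    ((1 + s * m) / ρ) * (ρ + s / s)  ≡⟨ step ρ (trans ρ≡ s²/s≡s) ⟩
    ((1 + s * m) / s) * (s + s / s)  ≡⟨ cong₂ (λ a b → a * (s + b)) quotient (n/n≡1 s) ⟩
    m * (s + 1)                      ∎
    where
    open ≡-Reasoning
    m : ℕ
    m = s ^ 2 ∸ 1
    step : ∀ ρ .{{_ : NonZero ρ}} → ρ ≡ s →
           ((1 + s * m) / ρ) * (ρ + s / s) ≡ ((1 + s * m) / s) * (s + s / s)
    step .s refl = refl
    s²/s≡s : s ^ 2 / s ≡ s
    s²/s≡s = trans (/-congˡ (cong (s *_) (*-identityʳ s))) (m*n/n≡m s s)
    quotient : (1 + s * m) / s ≡ m
    quotient = begin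
      (1 + s * m) / s    ≡⟨ /-congˡ (cong suc (*-comm s m)) ⟩
      (1 + m * s) / s    ≡⟨ +-distrib-/-∣ʳ 1 (n∣m*n m) ⟩
      -- The floor discards only the remainder 1.
      1 / s + m * s / s  ≡⟨ cong₂ _+_ (m<n⇒m/n≡0 1<s) (m*n/n≡m m s) ⟩
      m                  ∎

  mooreBound₃≡[s²∸1][s+1] :
    mooreBound₃ (s ^ 2) s {{square-nonZero 3≤s}} ≡ (s ^ 2 ∸ 1) * (s + 1)
  mooreBound₃≡[s²∸1][s+1] = mooreBound₃-eval _ _ {{_}} {{_}} gcd[s²,s]≡s refl

  order≢[s²∸1][s+1] : (G : Bigraph (s ^ 2) s 3) → Bigraph.order G ≢ (s ^ 2 ∸ 1) * (s + 1)
  order≢[s²∸1][s+1] G order≡ = <⇒≢ order<M order≡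
    where
    open ≤-Reasoning
    order<M : Bigraph.order G < (s ^ 2 ∸ 1) * (s + 1)
    order<M = begin-strict
      Bigraph.order G         ≡⟨ order≡N₁*[s+1] G ⟩
      Bigraph.N₁ G * (s + 1)  <⟨ *-monoˡ-< (s + 1) {{>-nonZero (m≤n+m 1 s)}}
                                   (≤-<-trans (N₁≤s²∸2 G) (∸-monoʳ-< (s≤s (s≤s z≤n)) 2≤s²)) ⟩
      (s ^ 2 ∸ 1) * (s + 1)   ∎

proposition1p2 : (s : ℕ) (3≤s : 3 ≤ s) →
    let M  = mooreBound₃ (s ^ 2) s {{square-nonZero 3≤s}}
        M* = (s ^ 2 ∸ 2) * (s + 1)
    in  M ≡ (s ^ 2 ∸ 1) + (s ^ 3 ∸ s)
      × ((G : Bigraph (s ^ 2) s 3) → Bigraph.order G ≢ M)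
      × ((G : Bigraph (s ^ 2) s 3) → Bigraph.order G ≤ M*)
      × M* ≡ (s ^ 2 ∸ 2) + (s ^ 3 ∸ 2 * s)
      × ((G : Bigraph (s ^ 2) s 3) → Bigraph.order G ≡ M* →
           Bigraph.N₁ G ≡ s ^ 2 ∸ 2 × Bigraph.N₂ G ≡ s ^ 3 ∸ 2 * s)
proposition1p2 s 3≤s =
    -- The same expansion serves `M` with `k = 1` and `M*` with `k = 2`.
    trans (mooreBound₃≡[s²∸1][s+1] 3≤s) (trans ([s²∸k][s+1] 3≤s 1)
      (cong (λ z → (s ^ 2 ∸ 1) + (s ^ 3 ∸ z)) (*-identityˡ s)))
  , (λ G order≡M → order≢[s²∸1][s+1] 3≤s G (trans order≡M (mooreBound₃≡[s²∸1][s+1] 3≤s)))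
  , (λ G → subst (_≤ (s ^ 2 ∸ 2) * (s + 1)) (sym (order≡N₁*[s+1] 3≤s G))
             (*-monoˡ-≤ (s + 1) (N₁≤s²∸2 3≤s G)))
  , [s²∸k][s+1] 3≤s 2
  , λ G order≡M* →
      -- The order is `N₁ * (s + 1)`, so it determines `N₁`, and then `N₂` as `s * N₁`.
      let N₁≡ = *-cancelʳ-≡ (Bigraph.N₁ G) (s ^ 2 ∸ 2) (s + 1) {{>-nonZero (m≤n+m 1 s)}}
                  (trans (sym (order≡N₁*[s+1] 3≤s G)) order≡M*)
      in N₁≡ , trans (N₂≡s*N₁ 3≤s G) (trans (cong (s *_) N₁≡)
           (trans (*-distribˡ-∸ s (s ^ 2) 2) (cong (s ^ 3 ∸_) (*-comm s 2))))
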